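{- Let $a$ and $x$ be indeterminates. For all positive integers $n$, $$\det_{0\le i,j\le n-1}\left(a^i\binom {x+i+j-1}j+\binom {x-i+j-1}j\right)=2(a-1)^{\binom n2}.$$
   Context: The binomial coefficient is $\binom{\alpha}{p}=\frac{\alpha(\alpha-1)\cdots(\alpha-p+1)}{p!}$ if $p\ge 0$ is an integer, and $0$ if $p<0$. -}

module Defs where

open import Level using (Level; 0ℓ)
open import Algebra.Bundles using (CommutativeMonoid; CommutativeRing)
open import Algebra.Structures using (IsCommutativeRing)
open import Data.Fin.Base using (Fin; zero; suc; toℕ; punchIn)
open import Data.Integer.Base using (ℤ; +_; -[1+_]; 1ℤ)
open import Data.List.Base using (List; []; _∷_; map)
open import Data.Nat.Base as ℕ using (ℕ; zero; suc; _!)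
open import Data.Nat.Properties using (_!≢0)
open import Data.Product.Base using (_,_)
open import Data.Rational.Base as ℚ using (ℚ)
import Data.Rational.Properties as ℚ
open import Relation.Binary.Structures using (IsEquivalence)

-- A polynomial is its list of coefficients, constant term first.  Trailing
-- zeros are allowed, so equality compares coefficients.
module Polynomial {c ℓ : Level} (R : CommutativeRing c ℓ) where

  open CommutativeRing R hiding (isCommutativeRing; zero)
  open import Algebra.Properties.Ring ring using (-0#≈0#)
  open import Algebra.Properties.CommutativeSemigroup
    (CommutativeMonoid.commutativeSemigroup +-commutativeMonoid)
    using (interchange)
  open import Relation.Binary.Reasoning.Setoid setoid

  Poly : Set c
  Poly = List Carrier

  coeff : Poly → ℕ → Carrier
  coeff []      _       = 0#
  coeff (a ∷ _) zero    = a
  coeff (_ ∷ p) (suc n) = coeff p n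

  infix 4 _≋_
  record _≋_ (p q : Poly) : Set ℓ where
    constructor coeffwise
    field at : ∀ n → coeff p n ≈ coeff q n
  open _≋_ public

  constant : Carrier → Poly
  constant a = a ∷ []

  X : Poly
  X = 0# ∷ 1# ∷ []

  infixl 6 _⊕_
  _⊕_ : Poly → Poly → Poly
  []      ⊕ q       = q
  (a ∷ p) ⊕ []      = a ∷ p
  (a ∷ p) ⊕ (b ∷ q) = a + b ∷ p ⊕ q

  ⊖_ : Poly → Poly
  ⊖ p = map -_ p

  infixr 7 _·_
  _·_ : Carrier → Poly → Poly
  a · p = map (a *_) p

  infixl 7 _⊛_
  _⊛_ : Poly → Poly → Poly
  []      ⊛ q = []
  (a ∷ p) ⊛ q = a · q ⊕ (0# ∷ p ⊛ q)

  coeff-⊕ : ∀ p q n → coeff (p ⊕ q) n ≈ coeff p n + coeff q n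
  coeff-⊕ []      q       n       = sym (+-identityˡ _)
  coeff-⊕ (a ∷ p) []      n       = sym (+-identityʳ _)
  coeff-⊕ (a ∷ p) (b ∷ q) zero    = refl
  coeff-⊕ (a ∷ p) (b ∷ q) (suc n) = coeff-⊕ p q n

  coeff-⊖ : ∀ p n → coeff (⊖ p) n ≈ - coeff p n
  coeff-⊖ []      n       = sym -0#≈0#
  coeff-⊖ (a ∷ p) zero    = refl
  coeff-⊖ (a ∷ p) (suc n) = coeff-⊖ p n

  coeff-· : ∀ a p n → coeff (a · p) n ≈ a * coeff p n
  coeff-· a []      n       = sym (zeroʳ a)
  coeff-· a (b ∷ p) zero    = refl
  coeff-· a (b ∷ p) (suc n) = coeff-· a p n

  ≋-isEquivalence : IsEquivalence _≋_
  ≋-isEquivalence = record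
    { refl  = coeffwise λ _ → refl
    ; sym   = λ e → coeffwise λ n → sym (at e n)
    ; trans = λ e f → coeffwise λ n → trans (at e n) (at f n)
    }

  open IsEquivalence ≋-isEquivalence
    using () renaming (refl to ≋-refl; sym to ≋-sym; trans to ≋-trans)

  ∷-cong : ∀ {a b p q} → a ≈ b → p ≋ q → a ∷ p ≋ b ∷ q
  ∷-cong e f = coeffwise λ { zero → e ; (suc n) → at f n }

  0∷[]≋[] : 0# ∷ [] ≋ []
  0∷[]≋[] = coeffwise λ { zero → refl ; (suc n) → refl }

  ⊕-cong : ∀ {p p′ q q′} → p ≋ p′ → q ≋ q′ → p ⊕ q ≋ p′ ⊕ q′
  ⊕-cong {p} {p′} {q} {q′} e f = coeffwise λ n → begin
    coeff (p ⊕ q) n         ≈⟨ coeff-⊕ p q n ⟩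
    coeff p n + coeff q n   ≈⟨ +-cong (at e n) (at f n) ⟩
    coeff p′ n + coeff q′ n ≈⟨ coeff-⊕ p′ q′ n ⟨
    coeff (p′ ⊕ q′) n       ∎

  ⊕-assoc : ∀ p q r → (p ⊕ q) ⊕ r ≋ p ⊕ (q ⊕ r)
  ⊕-assoc p q r = coeffwise λ n → begin
    coeff ((p ⊕ q) ⊕ r) n                 ≈⟨ coeff-⊕ (p ⊕ q) r n ⟩
    coeff (p ⊕ q) n + coeff r n           ≈⟨ +-congʳ (coeff-⊕ p q n) ⟩
    (coeff p n + coeff q n) + coeff r n   ≈⟨ +-assoc _ _ _ ⟩
    coeff p n + (coeff q n + coeff r n)   ≈⟨ +-congˡ (coeff-⊕ q r n) ⟨
    coeff p n + coeff (q ⊕ r) n           ≈⟨ coeff-⊕ p (q ⊕ r) n ⟨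
    coeff (p ⊕ (q ⊕ r)) n                 ∎

  ⊕-comm : ∀ p q → p ⊕ q ≋ q ⊕ p
  ⊕-comm p q = coeffwise λ n → begin
    coeff (p ⊕ q) n       ≈⟨ coeff-⊕ p q n ⟩
    coeff p n + coeff q n ≈⟨ +-comm _ _ ⟩
    coeff q n + coeff p n ≈⟨ coeff-⊕ q p n ⟨
    coeff (q ⊕ p) n       ∎

  ⊕-identityʳ : ∀ p → p ⊕ [] ≋ p
  ⊕-identityʳ p = ⊕-comm p []

  ⊖-cong : ∀ {p q} → p ≋ q → ⊖ p ≋ ⊖ q
  ⊖-cong {p} {q} e = coeffwise λ n →
    trans (coeff-⊖ p n) (trans (-‿cong (at e n)) (sym (coeff-⊖ q n)))

  ⊖-inverseˡ : ∀ p → ⊖ p ⊕ p ≋ []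
  ⊖-inverseˡ p = coeffwise λ n → begin
    coeff (⊖ p ⊕ p) n         ≈⟨ coeff-⊕ (⊖ p) p n ⟩
    coeff (⊖ p) n + coeff p n ≈⟨ +-congʳ (coeff-⊖ p n) ⟩
    - coeff p n + coeff p n   ≈⟨ -‿inverseˡ _ ⟩
    0#                        ∎

  ⊖-inverseʳ : ∀ p → p ⊕ ⊖ p ≋ []
  ⊖-inverseʳ p = ≋-trans (⊕-comm p (⊖ p)) (⊖-inverseˡ p)

  ⊕-medial : ∀ p q r s → (p ⊕ q) ⊕ (r ⊕ s) ≋ (p ⊕ r) ⊕ (q ⊕ s)
  ⊕-medial p q r s = coeffwise λ n → begin
    coeff ((p ⊕ q) ⊕ (r ⊕ s)) n
      ≈⟨ expand p q r s n ⟩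
    (coeff p n + coeff q n) + (coeff r n + coeff s n)
      ≈⟨ interchange _ _ _ _ ⟩
    (coeff p n + coeff r n) + (coeff q n + coeff s n)
      ≈⟨ expand p r q s n ⟨
    coeff ((p ⊕ r) ⊕ (q ⊕ s)) n ∎
    where
    expand : ∀ p q r s n → coeff ((p ⊕ q) ⊕ (r ⊕ s)) n
           ≈ (coeff p n + coeff q n) + (coeff r n + coeff s n)
    expand p q r s n =
      trans (coeff-⊕ (p ⊕ q) (r ⊕ s) n) (+-cong (coeff-⊕ p q n) (coeff-⊕ r s n))

  ⊕-swap : ∀ p q r → p ⊕ (q ⊕ r) ≋ q ⊕ (p ⊕ r)
  ⊕-swap p q r = ≋-trans (≋-sym (⊕-assoc p q r))
    (≋-trans (⊕-cong (⊕-comm p q) ≋-refl) (⊕-assoc q p r))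

  ·-congˡ : ∀ a {p q} → p ≋ q → a · p ≋ a · q
  ·-congˡ a {p} {q} e = coeffwise λ n →
    trans (coeff-· a p n) (trans (*-congˡ (at e n)) (sym (coeff-· a q n)))

  ·-zeroˡ : ∀ p → 0# · p ≋ []
  ·-zeroˡ p = coeffwise λ n → trans (coeff-· 0# p n) (zeroˡ _)

  ·-identityˡ : ∀ p → 1# · p ≋ p
  ·-identityˡ p = coeffwise λ n → trans (coeff-· 1# p n) (*-identityˡ _)

  ·-distribˡ : ∀ a p q → a · (p ⊕ q) ≋ a · p ⊕ a · q
  ·-distribˡ a p q = coeffwise λ n → begin
    coeff (a · (p ⊕ q)) n               ≈⟨ coeff-· a (p ⊕ q) n ⟩
    a * coeff (p ⊕ q) n                 ≈⟨ *-congˡ (coeff-⊕ p q n) ⟩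
    a * (coeff p n + coeff q n)         ≈⟨ distribˡ _ _ _ ⟩
    a * coeff p n + a * coeff q n       ≈⟨ +-cong (coeff-· a p n) (coeff-· a q n) ⟨
    coeff (a · p) n + coeff (a · q) n   ≈⟨ coeff-⊕ (a · p) (a · q) n ⟨
    coeff (a · p ⊕ a · q) n             ∎

  ·-assoc : ∀ a b p → (a * b) · p ≋ a · b · p
  ·-assoc a b p = coeffwise λ n → begin
    coeff ((a * b) · p) n ≈⟨ coeff-· (a * b) p n ⟩
    (a * b) * coeff p n   ≈⟨ *-assoc _ _ _ ⟩
    a * (b * coeff p n)   ≈⟨ *-congˡ (coeff-· b p n) ⟨
    a * coeff (b · p) n   ≈⟨ coeff-· a (b · p) n ⟨
    coeff (a · b · p) n   ∎

  ⊛-congˡ : ∀ p {q r} → q ≋ r → p ⊛ q ≋ p ⊛ r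
  ⊛-congˡ []      e = ≋-refl
  ⊛-congˡ (a ∷ p) e = ⊕-cong (·-congˡ a e) (∷-cong refl (⊛-congˡ p e))

  ⊛-zeroʳ : ∀ p → p ⊛ [] ≋ []
  ⊛-zeroʳ []      = ≋-refl
  ⊛-zeroʳ (a ∷ p) = ≋-trans (∷-cong refl (⊛-zeroʳ p)) 0∷[]≋[]

  ⊛-∷ʳ : ∀ p b q → p ⊛ (b ∷ q) ≋ b · p ⊕ (0# ∷ p ⊛ q)
  ⊛-∷ʳ []      b q = ≋-sym 0∷[]≋[]
  ⊛-∷ʳ (a ∷ p) b q = ∷-cong (+-congʳ (*-comm a b))
    (≋-trans (⊕-cong (≋-refl {a · q}) (⊛-∷ʳ p b q))
             (⊕-swap (a · q) (b · p) (0# ∷ p ⊛ q)))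

  ⊛-comm : ∀ p q → p ⊛ q ≋ q ⊛ p
  ⊛-comm []      q = ≋-sym (⊛-zeroʳ q)
  ⊛-comm (a ∷ p) q =
    ≋-trans (⊕-cong (≋-refl {a · q}) (∷-cong refl (⊛-comm p q)))
            (≋-sym (⊛-∷ʳ q a p))

  ⊛-cong : ∀ {p p′ q q′} → p ≋ p′ → q ≋ q′ → p ⊛ q ≋ p′ ⊛ q′
  ⊛-cong {p} {p′} {q} {q′} e f = ≋-trans (⊛-congˡ p f)
    (≋-trans (⊛-comm p q′) (≋-trans (⊛-congˡ q′ e) (⊛-comm q′ p′)))

  ⊛-distribˡ : ∀ p q r → p ⊛ (q ⊕ r) ≋ p ⊛ q ⊕ p ⊛ r
  ⊛-distribˡ []      q r = ≋-refl
  ⊛-distribˡ (a ∷ p) q r = ≋-trans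
    (⊕-cong (·-distribˡ a q r)
            (∷-cong (sym (+-identityʳ 0#)) (⊛-distribˡ p q r)))
    (⊕-medial (a · q) (a · r) (0# ∷ p ⊛ q) (0# ∷ p ⊛ r))

  ⊛-distribʳ : ∀ p q r → (q ⊕ r) ⊛ p ≋ q ⊛ p ⊕ r ⊛ p
  ⊛-distribʳ p q r = ≋-trans (⊛-comm (q ⊕ r) p)
    (≋-trans (⊛-distribˡ p q r) (⊕-cong (⊛-comm p q) (⊛-comm p r)))

  ·-⊛ : ∀ a p q → (a · p) ⊛ q ≋ a · (p ⊛ q)
  ·-⊛ a []      q = ≋-refl
  ·-⊛ a (b ∷ p) q = ≋-trans
    (⊕-cong (·-assoc a b q) (∷-cong (sym (zeroʳ a)) (·-⊛ a p q)))
    (≋-sym (·-distribˡ a (b · q) (0# ∷ p ⊛ q)))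

  ⊛-assoc : ∀ p q r → (p ⊛ q) ⊛ r ≋ p ⊛ (q ⊛ r)
  ⊛-assoc []      q r = ≋-refl
  ⊛-assoc (a ∷ p) q r = ≋-trans
    (⊛-distribʳ r (a · q) (0# ∷ p ⊛ q))
    (⊕-cong (·-⊛ a q r)
      (≋-trans (⊕-cong (·-zeroˡ r) ≋-refl) (∷-cong refl (⊛-assoc p q r))))

  ⊛-identityˡ : ∀ p → constant 1# ⊛ p ≋ p
  ⊛-identityˡ p = ≋-trans (⊕-cong (·-identityˡ p) 0∷[]≋[]) (⊕-identityʳ p)

  ⊛-identityʳ : ∀ p → p ⊛ constant 1# ≋ p
  ⊛-identityʳ p = ≋-trans (⊛-comm p (constant 1#)) (⊛-identityˡ p)

  isCommutativeRing : IsCommutativeRing _≋_ _⊕_ _⊛_ ⊖_ [] (constant 1#)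
  isCommutativeRing = record
    { isRing = record
      { +-isAbelianGroup = record
        { isGroup = record
          { isMonoid = record
            { isSemigroup = record
              { isMagma = record
                { isEquivalence = ≋-isEquivalence
                ; ∙-cong        = ⊕-cong
                }
              ; assoc = ⊕-assoc
              }
            ; identity = (λ _ → ≋-refl) , ⊕-identityʳ
            }
          ; inverse = ⊖-inverseˡ , ⊖-inverseʳ
          ; ⁻¹-cong = ⊖-cong
          }
        ; comm = ⊕-comm
        }
      ; *-cong     = ⊛-cong
      ; *-assoc    = ⊛-assoc
      ; *-identity = ⊛-identityˡ , ⊛-identityʳ
      ; distrib    = ⊛-distribˡ , ⊛-distribʳ
      }
    ; *-comm = ⊛-comm
    }

  commutativeRing : CommutativeRing c ℓ
  commutativeRing = record { isCommutativeRing = isCommutativeRing }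

module Determinant {c ℓ : Level} (R : CommutativeRing c ℓ) where

  open CommutativeRing R hiding (zero)
  open import Algebra.Properties.Semiring.Exp semiring using (_^_)
  open import Algebra.Properties.Semiring.Sum semiring using (sum)

  -- Laplace expansion along the first row.
  det : (n : ℕ) → (Fin n → Fin n → Carrier) → Carrier
  det zero    M = 1#
  det (suc n) M = sum λ j →
    (- 1#) ^ toℕ j * M zero j * det n (λ k l → M (suc k) (punchIn j l))

-- The map `scalar` is meant to be the structure map of a ℚ-algebra R.
module Binomial {c ℓ : Level} (R : CommutativeRing c ℓ)
                (scalar : ℚ → CommutativeRing.Carrier R) where

  open CommutativeRing R hiding (zero)
  open import Algebra.Properties.Semiring.Mult semiring using (_×_)

  fallingFactorial : Carrier → ℕ → Carrier
  fallingFactorial α zero    = 1#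
  fallingFactorial α (suc p) = fallingFactorial α p * (α - p × 1#)

  1/_! : ℕ → ℚ
  1/ p ! = (1ℤ ℚ./ (p !)) {{p !≢0}}

  binomial : Carrier → ℤ → Carrier
  binomial α (+ p)    = scalar (1/ p !) * fallingFactorial α p
  binomial α -[1+ _ ] = 0#

ℚ-ring : CommutativeRing 0ℓ 0ℓ
ℚ-ring = ℚ.+-*-commutativeRing

ℚ[a] : CommutativeRing 0ℓ 0ℓ
ℚ[a] = Polynomial.commutativeRing ℚ-ring

ℚ[a,x] : CommutativeRing 0ℓ 0ℓ
ℚ[a,x] = Polynomial.commutativeRing ℚ[a]

scalar : ℚ → CommutativeRing.Carrier ℚ[a,x]
scalar q = Polynomial.constant ℚ[a] (Polynomial.constant ℚ-ring q)

a : CommutativeRing.Carrier ℚ[a,x]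
a = Polynomial.constant ℚ[a] (Polynomial.X ℚ-ring)

x : CommutativeRing.Carrier ℚ[a,x]
x = Polynomial.X ℚ[a]

open CommutativeRing ℚ[a,x] public
  using (Carrier; _≈_; _+_; _*_; _-_; 1#)
open import Algebra.Properties.Semiring.Exp
  (CommutativeRing.semiring ℚ[a,x]) public using (_^_)
open import Algebra.Properties.Semiring.Mult
  (CommutativeRing.semiring ℚ[a,x]) public using (_×_)
open Determinant ℚ[a,x] public using (det)
open Binomial ℚ[a,x] scalar public using (binomial)

fromℕ : ℕ → Carrier
fromℕ n = n × 1#

module Submission where

-- Put u = a / (1 - t) and v = 1 - t, so that u v = a.  The generating function
-- in t of row i is (1 - t)^(-x) (uⁱ + vⁱ), and for i ≥ 1 the factor uⁱ + vⁱ is a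
-- monic polynomial of degree i in w = u + v - (a + 1) = (a - 1) t + a t² + ⋯, while
-- it is 2 for i = 0.  Hence the matrix is the product of a lower triangular matrix
-- with diagonal 2, 1, 1, … and the matrix of coefficients of (1 - t)^(-x) wᵏ, which
-- is upper triangular with diagonal (a - 1)ᵏ.

-- The sum uⁱ + vⁱ is symmetric in u and v, and u v = a does not involve t, so it is a polynomial in
-- u + v alone. The constant a + 1 is the value of u + v at t = 0; subtracting it leaves a series w
-- without constant term, and this makes the second factor triangular. Series are represented by
-- coefficient sequences, with multiplication by 1 / (1 - t) and by w as operations on them. What
-- enters about binomial coefficients is Pascal's rule and the value 1 at lower index 0. The
-- determinant is given by expansion along the first row, so the product rule for a triangular left
-- factor has to be derived from expansions. The obstacle is that adding multiples of the first row
-- to all other rows changes every minor at once, and a minor that omits the first row no longer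
-- contains the row being added. Rank-one updates of a matrix are the generalization under which the
-- induction closes.

open import Defs using (module Polynomial; module Determinant; module Binomial; ℚ-ring; ℚ[a])
open import Algebra.Bundles using (CommutativeMonoid; CommutativeRing; RawRing)
import Algebra.Properties.CommutativeMonoid.Sum
import Algebra.Solver.Ring
open import Algebra.Solver.Ring.AlmostCommutativeRing
  using (fromCommutativeRing; _-Raw-AlmostCommutative⟶_)
open import Data.Fin.Base as Fin using (Fin; zero; suc; toℕ; punchIn)
open import Data.Fin.Properties using (toℕ<n)
open import Data.Integer.Base as ℤ using (+_; 1ℤ)
import Data.Integer.Properties as ℤ
import Data.Integer.Solver as ℤ
open import Data.Maybe.Base using (Maybe; map)
open import Data.Nat.Base as ℕ using (ℕ; zero; suc; z≤n; s≤s; NonZero; _!)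
open import Data.Nat.Combinatorics using (_C_; nC1≡n; nCk+nC[k+1]≡[n+1]C[k+1])
open import Data.Nat.Properties as ℕ using (_!≢0)
open import Data.Product.Base as Product using (_,_)
import Data.Rational.Base as ℚ
import Data.Rational.Properties as ℚ
open import Data.Rational.Unnormalised.Base as ℚᵘ using (mkℚᵘ; *≡*)
import Data.Rational.Unnormalised.Properties as ℚᵘ
open import Data.Vec.Functional using (Vector; _∷_; head; tail)
open import Function.Base using (_∘_)
open import Level using (Level; 0ℓ)
open import Relation.Binary.Consequences using (dec⇒weaklyDec)
open import Relation.Binary.PropositionalEquality.Core as ≡ using (_≡_)

-- A ring solver with integer coefficients, written as reduced formal
-- differences m − n: unlike coefficients in R, their equality is decidable.
module IntegerSolver {c ℓ : Level} (R : CommutativeRing c ℓ) where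

  open CommutativeRing R hiding (zero)
  open import Algebra.Properties.Ring ring
  open import Algebra.Properties.CommutativeSemigroup
    (CommutativeMonoid.commutativeSemigroup +-commutativeMonoid)
    using (interchange)
  open import Algebra.Properties.Semiring.Mult.TCOptimised semiring
  open import Relation.Binary.Reasoning.Setoid setoid

  -- Without reduction, equal normal forms could fail to be definitionally equal.
  reduce : ℕ → ℕ → ℕ Product.× ℕ
  reduce (suc m) (suc n) = reduce m n
  reduce m       n       = m , n

  differences : RawRing 0ℓ 0ℓ
  differences = record
    { Carrier = ℕ Product.× ℕ
    ; _≈_     = λ (m , n) (m′ , n′) → m ℕ.+ n′ ≡ m′ ℕ.+ n
    ; _+_     = λ (m , n) (m′ , n′) → reduce (m ℕ.+ m′) (n ℕ.+ n′)
    ; _*_     = λ (m , n) (m′ , n′) → reduce (m ℕ.* m′ ℕ.+ n ℕ.* n′) (m ℕ.* n′ ℕ.+ n ℕ.* m′)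
    ; -_      = λ (m , n) → n , m
    ; 0#      = 0 , 0
    ; 1#      = 1 , 0
    }

  -- The case without subtraction makes `con (0 , 0)` and `con (1 , 0)` denote `0#` and `1#`
  -- definitionally, so that solved equations match goals containing these constants.
  difference : ℕ Product.× ℕ → Carrier
  difference (m , zero)      = m × 1#
  difference (m , n@(suc _)) = m × 1# - n × 1#

  private
    x-0≈x : ∀ x → x - 0# ≈ x
    x-0≈x x = trans (+-congˡ -0#≈0#) (+-identityʳ x)

    difference-def : ∀ m n → difference (m , n) ≈ m × 1# - n × 1#
    difference-def m zero    = sym (x-0≈x _)
    difference-def m (suc n) = refl

    -‿interchange : ∀ x y z w → (x + y) - (z + w) ≈ (x - z) + (y - w)
    -‿interchange x y z w = begin
      (x + y) - (z + w)     ≈⟨ +-congˡ (-‿+-comm z w) ⟨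
      (x + y) + (- z - w)   ≈⟨ interchange x y (- z) (- w) ⟩
      (x - z) + (y - w)     ∎

    x-y-distrib : ∀ x y z w → (x * z + y * w) - (x * w + y * z) ≈ (x - y) * (z - w)
    x-y-distrib x y z w = begin
      (x * z + y * w) - (x * w + y * z)
        ≈⟨ -‿interchange (x * z) (y * w) (x * w) (y * z) ⟩
      (x * z - x * w) + (y * w - y * z)
        ≈⟨ +-congˡ (trans (sym (-‿involutive _)) (-‿cong (sym (-‿+-comm _ _)))) ⟩
      (x * z - x * w) - (- (y * w) - - (y * z))
        ≈⟨ +-congˡ (-‿cong (trans (+-congˡ (-‿involutive _)) (+-comm _ _))) ⟩
      (x * z - x * w) - (y * z - y * w)
        ≈⟨ +-cong (x[y-z]≈xy-xz x z w) (-‿cong (x[y-z]≈xy-xz y z w)) ⟨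
      x * (z - w) - y * (z - w)
        ≈⟨ [y-z]x≈yx-zx (z - w) x y ⟨
      (x - y) * (z - w) ∎

    cancel : ∀ m n k → (m ℕ.+ k) × 1# - (n ℕ.+ k) × 1# ≈ m × 1# - n × 1#
    cancel m n k = begin
      (m ℕ.+ k) × 1# - (n ℕ.+ k) × 1#
        ≈⟨ +-cong (×-homo-+ 1# m k) (-‿cong (×-homo-+ 1# n k)) ⟩
      (m × 1# + k × 1#) - (n × 1# + k × 1#)
        ≈⟨ -‿interchange _ _ _ _ ⟩
      (m × 1# - n × 1#) + (k × 1# - k × 1#)
        ≈⟨ +-congˡ (-‿inverseʳ _) ⟩
      (m × 1# - n × 1#) + 0#
        ≈⟨ +-identityʳ _ ⟩
      m × 1# - n × 1# ∎

    difference-reduce : ∀ m n → difference (reduce m n) ≈ m × 1# - n × 1#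
    difference-reduce zero    n       = difference-def zero n
    difference-reduce (suc m) zero    = difference-def (suc m) zero
    difference-reduce (suc m) (suc n) = begin
      difference (reduce m n)           ≈⟨ difference-reduce m n ⟩
      m × 1# - n × 1#                   ≈⟨ cancel m n 1 ⟨
      (m ℕ.+ 1) × 1# - (n ℕ.+ 1) × 1#   ≡⟨ ≡.cong₂ (λ k l → k × 1# - l × 1#) (ℕ.+-comm m 1) (ℕ.+-comm n 1) ⟩
      suc m × 1# - suc n × 1#           ∎

    homomorphism : differences -Raw-AlmostCommutative⟶ fromCommutativeRing R
    homomorphism = record
      { ⟦_⟧    = difference
      ; +-homo = λ (m , n) (m′ , n′) → begin
          difference (reduce (m ℕ.+ m′) (n ℕ.+ n′))
            ≈⟨ difference-reduce (m ℕ.+ m′) (n ℕ.+ n′) ⟩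
          (m ℕ.+ m′) × 1# - (n ℕ.+ n′) × 1#
            ≈⟨ +-cong (×-homo-+ 1# m m′) (-‿cong (×-homo-+ 1# n n′)) ⟩
          (m × 1# + m′ × 1#) - (n × 1# + n′ × 1#)
            ≈⟨ -‿interchange _ _ _ _ ⟩
          (m × 1# - n × 1#) + (m′ × 1# - n′ × 1#)
            ≈⟨ +-cong (difference-def m n) (difference-def m′ n′) ⟨
          difference (m , n) + difference (m′ , n′) ∎
      ; *-homo = λ (m , n) (m′ , n′) → begin
          difference (reduce (m ℕ.* m′ ℕ.+ n ℕ.* n′) (m ℕ.* n′ ℕ.+ n ℕ.* m′))
            ≈⟨ difference-reduce (m ℕ.* m′ ℕ.+ n ℕ.* n′) (m ℕ.* n′ ℕ.+ n ℕ.* m′) ⟩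
          (m ℕ.* m′ ℕ.+ n ℕ.* n′) × 1# - (m ℕ.* n′ ℕ.+ n ℕ.* m′) × 1#
            ≈⟨ +-cong (sum-of-products m m′ n n′) (-‿cong (sum-of-products m n′ n m′)) ⟩
          (m × 1# * (m′ × 1#) + n × 1# * (n′ × 1#)) - (m × 1# * (n′ × 1#) + n × 1# * (m′ × 1#))
            ≈⟨ x-y-distrib _ _ _ _ ⟩
          (m × 1# - n × 1#) * (m′ × 1# - n′ × 1#)
            ≈⟨ *-cong (difference-def m n) (difference-def m′ n′) ⟨
          difference (m , n) * difference (m′ , n′) ∎
      ; -‿homo = λ (m , n) → begin
          difference (n , m)      ≈⟨ difference-def n m ⟩
          n × 1# - m × 1#         ≈⟨ +-comm _ _ ⟩
          - (m × 1#) + n × 1#     ≈⟨ +-congˡ (-‿involutive _) ⟨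
          - (m × 1#) - - (n × 1#) ≈⟨ -‿+-comm _ _ ⟩
          - (m × 1# - n × 1#)     ≈⟨ -‿cong (difference-def m n) ⟨
          - difference (m , n)    ∎
      ; 0-homo = refl
      ; 1-homo = refl
      }
      where
      sum-of-products : ∀ m m′ n n′ →
        (m ℕ.* m′ ℕ.+ n ℕ.* n′) × 1# ≈ m × 1# * (m′ × 1#) + n × 1# * (n′ × 1#)
      sum-of-products m m′ n n′ = trans (×-homo-+ 1# (m ℕ.* m′) (n ℕ.* n′))
        (+-cong (×1-homo-* m m′) (×1-homo-* n n′))

    difference-cong : ∀ m n m′ n′ → m ℕ.+ n′ ≡ m′ ℕ.+ n →
                      difference (m , n) ≈ difference (m′ , n′)
    difference-cong m n m′ n′ eq = begin
      difference (m , n)   ≈⟨ difference-def m n ⟩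
      m × 1# - n × 1#      ≈⟨ cancel m n n′ ⟨
      (m ℕ.+ n′) × 1# - (n ℕ.+ n′) × 1#
        ≡⟨ ≡.cong₂ (λ k l → k × 1# - l × 1#) eq (ℕ.+-comm n n′) ⟩
      (m′ ℕ.+ n) × 1# - (n′ ℕ.+ n) × 1#
        ≈⟨ cancel m′ n′ n ⟩
      m′ × 1# - n′ × 1#    ≈⟨ difference-def m′ n′ ⟨
      difference (m′ , n′) ∎

    difference-≟ : ∀ p q → Maybe (difference p ≈ difference q)
    difference-≟ (m , n) (m′ , n′) =
      map (difference-cong m n m′ n′) (dec⇒weaklyDec ℕ._≟_ (m ℕ.+ n′) (m′ ℕ.+ n))

  open Algebra.Solver.Ring differences (fromCommutativeRing R) homomorphism difference-≟ public
    using (Polynomial; solve; con; _:=_; _:+_; _:*_; _:-_; :-_)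

-- Determinants from Laplace expansion

module DeterminantProperties {c ℓ : Level} (R : CommutativeRing c ℓ) where

  open CommutativeRing R hiding (zero)
  open Determinant R
  open IntegerSolver R
  open import Algebra.Properties.Ring ring
  open import Algebra.Properties.Semiring.Exp semiring using (_^_)
  open import Algebra.Properties.Semiring.Sum semiring
    using (sum; sum-cong-≋; *-distribˡ-sum; sum-replicate-zero)
  open Algebra.Properties.CommutativeMonoid.Sum *-commutativeMonoid public
    using () renaming (sum to ∏; sum-cong-≋ to ∏-cong)
  open import Algebra.Properties.CommutativeSemigroup
    (CommutativeMonoid.commutativeSemigroup *-commutativeMonoid) using (x∙yz≈y∙xz)
  open import Relation.Binary.Reasoning.Setoid setoid

  -- Opaque, so that unification does not unfold it on vectors of known length.
  opaque
    alternatingSum : ∀ {n} → Vector Carrier n → Carrier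
    alternatingSum {zero}  f = 0#
    alternatingSum {suc n} f = head f - alternatingSum (tail f)

    alternatingSum-empty : (f : Vector Carrier 0) → alternatingSum f ≈ 0#
    alternatingSum-empty f = refl

    alternatingSum-suc : ∀ {n} (f : Vector Carrier (suc n)) →
      alternatingSum f ≈ head f - alternatingSum (tail f)
    alternatingSum-suc f = refl

    alternatingSum-cong : ∀ {n} {f g : Vector Carrier n} →
      (∀ i → f i ≈ g i) → alternatingSum f ≈ alternatingSum g
    alternatingSum-cong {zero}  e = refl
    alternatingSum-cong {suc n} e = +-cong (e zero) (-‿cong (alternatingSum-cong (e ∘ suc)))

    alternatingSum-+ : ∀ {n} (f g : Vector Carrier n) →
      alternatingSum (λ i → f i + g i) ≈ alternatingSum f + alternatingSum g
    alternatingSum-+ {zero}  f g = sym (+-identityˡ 0#)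
    alternatingSum-+ {suc n} f g = trans
      (+-congˡ (-‿cong (alternatingSum-+ (tail f) (tail g))))
      (solve 4 (λ x y s t → (x :+ y) :- (s :+ t) := (x :- s) :+ (y :- t)) refl _ _ _ _)

    *-distribˡ-alternatingSum : ∀ {n} x (f : Vector Carrier n) →
      x * alternatingSum f ≈ alternatingSum (λ i → x * f i)
    *-distribˡ-alternatingSum {zero}  x f = zeroʳ x
    *-distribˡ-alternatingSum {suc n} x f = trans (x[y-z]≈xy-xz x _ _)
      (+-congˡ (-‿cong (*-distribˡ-alternatingSum x (tail f))))

  alternatingSum-zero : ∀ {n} {f : Vector Carrier n} →
    (∀ i → f i ≈ 0#) → alternatingSum f ≈ 0#
  alternatingSum-zero {n} {f} e = begin
    alternatingSum f
      ≈⟨ alternatingSum-cong (λ i → trans (e i) (sym (zeroˡ (f i)))) ⟩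
    alternatingSum (λ i → 0# * f i)
      ≈⟨ *-distribˡ-alternatingSum 0# f ⟨
    0# * alternatingSum f
      ≈⟨ zeroˡ _ ⟩
    0# ∎

  alternatingSum-neg : ∀ {n} (f : Vector Carrier n) →
    alternatingSum (λ i → - f i) ≈ - alternatingSum f
  alternatingSum-neg f = begin
    alternatingSum (λ i → - f i)      ≈⟨ alternatingSum-cong (λ i → -1*x≈-x (f i)) ⟨
    alternatingSum (λ i → - 1# * f i) ≈⟨ *-distribˡ-alternatingSum (- 1#) f ⟨
    - 1# * alternatingSum f           ≈⟨ -1*x≈-x _ ⟩
    - alternatingSum f                ∎

  alternatingSum-comm : ∀ {m n} (f : Fin m → Fin n → Carrier) →
    alternatingSum (λ i → alternatingSum (f i)) ≈
    alternatingSum (λ j → alternatingSum (λ i → f i j))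
  alternatingSum-comm {zero}  f = trans (alternatingSum-empty _)
    (sym (alternatingSum-zero (λ _ → alternatingSum-empty _)))
  alternatingSum-comm {suc m} f = begin
    alternatingSum (λ i → alternatingSum (f i))
      ≈⟨ alternatingSum-suc _ ⟩
    alternatingSum (f zero) - alternatingSum (λ i → alternatingSum (f (suc i)))
      ≈⟨ +-congˡ (-‿cong (alternatingSum-comm (f ∘ suc))) ⟩
    alternatingSum (f zero) - alternatingSum (λ j → alternatingSum (λ i → f (suc i) j))
      ≈⟨ +-congˡ (alternatingSum-neg _) ⟨
    alternatingSum (f zero) + alternatingSum (λ j → - alternatingSum (λ i → f (suc i) j))
      ≈⟨ alternatingSum-+ (f zero) _ ⟨
    alternatingSum (λ j → f zero j - alternatingSum (λ i → f (suc i) j))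
      ≈⟨ alternatingSum-cong (λ j → alternatingSum-suc (λ i → f i j)) ⟨
    alternatingSum (λ j → alternatingSum (λ i → f i j)) ∎

  sum-alternating : ∀ {n} (f : Vector Carrier n) →
    sum (λ i → (- 1#) ^ toℕ i * f i) ≈ alternatingSum f
  sum-alternating {zero}  f = sym (alternatingSum-empty f)
  sum-alternating {suc n} f = trans (+-cong (*-identityˡ _) (begin
    sum (λ i → - 1# * (- 1#) ^ toℕ i * f (suc i))
      ≈⟨ sum-cong-≋ (λ i → *-assoc (- 1#) ((- 1#) ^ toℕ i) (f (suc i))) ⟩
    sum (λ i → - 1# * ((- 1#) ^ toℕ i * f (suc i)))
      ≈⟨ *-distribˡ-sum (- 1#) (λ i → (- 1#) ^ toℕ i * f (suc i)) ⟨
    - 1# * sum (λ i → (- 1#) ^ toℕ i * f (suc i))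
      ≈⟨ -1*x≈-x _ ⟩
    - sum (λ i → (- 1#) ^ toℕ i * f (suc i))
      ≈⟨ -‿cong (sum-alternating (tail f)) ⟩
    - alternatingSum (tail f) ∎)) (sym (alternatingSum-suc f))

  Matrix : ℕ → ℕ → Set c
  Matrix m n = Fin m → Fin n → Carrier

  minor : ∀ {m n} → Matrix (suc m) (suc n) → Fin (suc m) → Fin (suc n) → Matrix m n
  minor M i j k l = M (punchIn i k) (punchIn j l)

  opaque
    -- A sealed copy of `det`, which would unfold to a sum as soon as the size is a successor and so
    -- hide the matrix from unification.
    determinant : ∀ {n} → Matrix n n → Carrier
    determinant {n} = det n

    det≈determinant : ∀ {n} (M : Matrix n n) → det n M ≈ determinant M
    det≈determinant M = refl

    determinant-empty : (M : Matrix 0 0) → determinant M ≈ 1#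
    determinant-empty M = refl

    determinant-cong : ∀ {n} {M N : Matrix n n} →
      (∀ i j → M i j ≈ N i j) → determinant M ≈ determinant N
    determinant-cong {zero}          e = refl
    determinant-cong {suc n} {M} {N} e = sum-cong-≋ λ j →
      *-cong (*-congˡ {x = (- 1#) ^ toℕ j} (e zero j))
             (determinant-cong (λ k l → e (suc k) (punchIn j l)))

    determinant-firstRow : ∀ {n} (M : Matrix (suc n) (suc n)) →
      determinant M ≈ alternatingSum (λ j → M zero j * determinant (minor M zero j))
    determinant-firstRow {n} M = trans
      (sum-cong-≋ {suc n} (λ j → *-assoc ((- 1#) ^ toℕ j) (M zero j) (det n (minor M zero j))))
      (sum-alternating _)

  -- Expand the minors of the first row along their first columns: apart from
  -- the corner entry, both expansions become the same double sum.
  determinant-firstColumn : ∀ {n} (M : Matrix (suc n) (suc n)) →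
    determinant M ≈ alternatingSum (λ i → M i zero * determinant (minor M i zero))
  determinant-firstColumn {zero}  M = trans (determinant-firstRow M)
    (alternatingSum-cong λ { zero → refl })
  determinant-firstColumn {suc n} M = begin
    determinant M
      ≈⟨ trans (determinant-firstRow M) (alternatingSum-suc _) ⟩
    corner - alternatingSum (λ j → M zero (suc j) * determinant (minor M zero (suc j)))
      ≈⟨ +-congˡ (-‿cong double-sum) ⟩
    corner - alternatingSum (λ i → M (suc i) zero * determinant (minor M (suc i) zero))
      ≈⟨ alternatingSum-suc _ ⟨
    alternatingSum (λ i → M i zero * determinant (minor M i zero)) ∎
    where
    corner : Carrier
    corner = M zero zero * determinant (minor M zero zero)

    -- Rows `zero`, `suc i` and columns `zero`, `suc j` of `M` are gone. Deleting them in either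
    -- order gives definitionally the same matrix, because `punchIn (suc j)` fixes `zero` and acts
    -- as `punchIn j` under `suc`.
    E : Matrix (suc n) (suc n)
    E i j = determinant (minor (minor M zero zero) i j)

    double-sum :
      alternatingSum (λ j → M zero (suc j) * determinant (minor M zero (suc j))) ≈
      alternatingSum (λ i → M (suc i) zero * determinant (minor M (suc i) zero))
    double-sum = begin
      alternatingSum (λ j → M zero (suc j) * determinant (minor M zero (suc j)))
        ≈⟨ alternatingSum-cong (λ j → trans (*-congˡ (determinant-firstColumn (minor M zero (suc j))))
             (*-distribˡ-alternatingSum (M zero (suc j)) _)) ⟩
      alternatingSum (λ j → alternatingSum (λ i → M zero (suc j) * (M (suc i) zero * E i j)))
        ≈⟨ alternatingSum-comm _ ⟩
      alternatingSum (λ i → alternatingSum (λ j → M zero (suc j) * (M (suc i) zero * E i j)))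
        ≈⟨ alternatingSum-cong (λ i → trans
             (alternatingSum-cong (λ j → x∙yz≈y∙xz (M zero (suc j)) (M (suc i) zero) (E i j)))
             (sym (*-distribˡ-alternatingSum (M (suc i) zero) _))) ⟩
      alternatingSum (λ i → M (suc i) zero * alternatingSum (λ j → M zero (suc j) * E i j))
        ≈⟨ alternatingSum-cong (λ i → *-congˡ (determinant-firstRow (minor M (suc i) zero))) ⟨
      alternatingSum (λ i → M (suc i) zero * determinant (minor M (suc i) zero)) ∎

  -- In the expansion along the first column the two top terms trade places and thereby signs. Every
  -- other minor still has the two rows on top, so it changes sign by induction. Pointwise
  -- hypotheses let the minors be compared without an explicit permutation.
  determinant-swap : ∀ n (M N : Matrix (suc (suc n)) (suc (suc n))) →
    (∀ l → M zero l ≈ N (suc zero) l) →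
    (∀ l → M (suc zero) l ≈ N zero l) →
    (∀ k l → M (suc (suc k)) l ≈ N (suc (suc k)) l) →
    determinant M ≈ - determinant N
  determinant-swap n M N e₀ e₁ e = begin
    determinant M
      ≈⟨ expand M ⟩
    M zero zero * D M zero - (M (suc zero) zero * D M (suc zero) - rest M)
      ≈⟨ +-cong (*-cong (e₀ zero) (determinant-cong λ { zero l → e₁ (suc l) ; (suc k) l → e k (suc l) }))
           (-‿cong (+-cong
             (*-cong (e₁ zero) (determinant-cong λ { zero l → e₀ (suc l) ; (suc k) l → e k (suc l) }))
             (-‿cong rest-swap))) ⟩
    N (suc zero) zero * D N (suc zero) - (N zero zero * D N zero - - rest N)
      ≈⟨ solve 3 (λ x y z → x :- (y :- :- z) := :- (y :- (x :- z))) refl _ _ _ ⟩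
    - (N zero zero * D N zero - (N (suc zero) zero * D N (suc zero) - rest N))
      ≈⟨ -‿cong (expand N) ⟨
    - determinant N ∎
    where
    D : Matrix (suc (suc n)) (suc (suc n)) → Vector Carrier (suc (suc n))
    D M i = determinant (minor M i zero)

    rest : Matrix (suc (suc n)) (suc (suc n)) → Carrier
    rest M = alternatingSum (λ i → M (suc (suc i)) zero * D M (suc (suc i)))

    expand : ∀ M → determinant M ≈
      M zero zero * D M zero - (M (suc zero) zero * D M (suc zero) - rest M)
    expand M = trans (determinant-firstColumn M) (trans (alternatingSum-suc _)
      (+-congˡ (-‿cong (alternatingSum-suc _))))

    -- Quantified over `n` anew so that it can be matched: a lower row `i` exists only if `n` is a
    -- successor, which provides the smaller size for the recursion.
    D-swap : ∀ n (M N : Matrix (suc (suc n)) (suc (suc n))) →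
      (∀ l → M zero l ≈ N (suc zero) l) →
      (∀ l → M (suc zero) l ≈ N zero l) →
      (∀ k l → M (suc (suc k)) l ≈ N (suc (suc k)) l) →
      ∀ i → determinant (minor M (suc (suc i)) zero) ≈ - determinant (minor N (suc (suc i)) zero)
    D-swap (suc n) M N e₀ e₁ e i = determinant-swap n _ _
      (λ l → e₀ (suc l)) (λ l → e₁ (suc l)) (λ k l → e (punchIn i k) (suc l))

    rest-swap : rest M ≈ - rest N
    rest-swap = trans
      (alternatingSum-cong λ i → trans (*-cong (e i zero) (D-swap n M N e₀ e₁ e i))
        (sym (-‿distribʳ-* _ _)))
      (alternatingSum-neg _)

  -- Each statement follows from smaller cases of both by expanding its determinant:
  -- the first along its first column, the second along its first row, where
  -- determinant-swap brings r to the top.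
  mutual

    determinant-addFirstRow : ∀ n (c : Vector Carrier n) (M N : Matrix (suc n) (suc n)) →
      (∀ l → M zero l ≈ N zero l) →
      (∀ i l → M (suc i) l ≈ N (suc i) l + c i * N zero l) →
      determinant M ≈ determinant N
    determinant-addFirstRow zero    c M N e₀ e = determinant-cong λ { zero → e₀ }
    determinant-addFirstRow (suc n) c M N e₀ e = begin
      determinant M
        ≈⟨ trans (determinant-firstColumn M) (alternatingSum-suc _) ⟩
      M zero zero * determinant (minor M zero zero) -
        alternatingSum (λ i → M (suc i) zero * determinant (minor M (suc i) zero))
        ≈⟨ +-cong (*-cong (e₀ zero) (trans corner
             (+-congˡ (alternatingSum-cong λ i → *-congˡ (determinant-cong
               λ { zero l → refl ; (suc k) l → refl })))))
             (-‿cong rest) ⟩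
      N zero zero * (determinant (minor N zero zero) + alternatingSum (λ i → c i * D i)) -
        (alternatingSum (λ i → N (suc i) zero * D i) + N zero zero * alternatingSum (λ i → c i * D i))
        -- The multiples `c i` enter twice, through the corner minor and through the first column;
        -- the two contributions are equal and cancel.
        ≈⟨ solve 4 (λ x d s t → x :* (d :+ s) :- (t :+ x :* s) := x :* d :- t) refl _ _ _ _ ⟩
      N zero zero * determinant (minor N zero zero) - alternatingSum (λ i → N (suc i) zero * D i)
        ≈⟨ trans (determinant-firstColumn N) (alternatingSum-suc _) ⟨
      determinant N ∎
      where
      D : Vector Carrier (suc n)
      D i = determinant (minor N (suc i) zero)

      -- The corner minor has lost the row that is added, so here the change is a genuine rank-one
      -- update.
      corner : determinant (minor M zero zero) ≈ determinant (minor N zero zero) +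
        alternatingSum (λ i → c i * determinant
          (tail (N zero) ∷ (λ k → minor N zero zero (punchIn i k))))
      corner = determinant-rankOneUpdate n c (tail (N zero)) _ _ (λ i l → e i (suc l))

      rest : alternatingSum (λ i → M (suc i) zero * determinant (minor M (suc i) zero)) ≈
             alternatingSum (λ i → N (suc i) zero * D i) +
             N zero zero * alternatingSum (λ i → c i * D i)
      rest = begin
        alternatingSum (λ i → M (suc i) zero * determinant (minor M (suc i) zero))
          ≈⟨ alternatingSum-cong (λ i → trans
               (*-cong (e i zero) (determinant-addFirstRow n (c ∘ punchIn i) _ _
                 (λ l → e₀ (suc l)) (λ k l → e (punchIn i k) (suc l))))
               (solve 4 (λ y c x d → (y :+ c :* x) :* d := y :* d :+ x :* (c :* d)) refl
                 _ _ _ _)) ⟩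
        alternatingSum (λ i → N (suc i) zero * D i + N zero zero * (c i * D i))
          ≈⟨ alternatingSum-+ _ _ ⟩
        alternatingSum (λ i → N (suc i) zero * D i) +
          alternatingSum (λ i → N zero zero * (c i * D i))
          ≈⟨ +-congˡ (*-distribˡ-alternatingSum (N zero zero) _) ⟨
        alternatingSum (λ i → N (suc i) zero * D i) +
          N zero zero * alternatingSum (λ i → c i * D i) ∎

    determinant-rankOneUpdate : ∀ n (c r : Vector Carrier (suc n)) (M N : Matrix (suc n) (suc n)) →
      (∀ i l → M i l ≈ N i l + c i * r l) →
      determinant M ≈
      determinant N + alternatingSum (λ i → c i * determinant (r ∷ (λ k → N (punchIn i k))))
    determinant-rankOneUpdate n c r M N e = begin
      determinant M
        ≈⟨ determinant-firstRow M ⟩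
      alternatingSum (λ j → M zero j * D j)
        ≈⟨ alternatingSum-cong (λ j → trans (*-congʳ (e zero j))
             (solve 4 (λ y c x d → (y :+ c :* x) :* d := y :* d :+ c :* (x :* d)) refl
               _ _ _ _)) ⟩
      alternatingSum (λ j → N zero j * D j + c zero * (r j * D j))
        ≈⟨ alternatingSum-+ _ _ ⟩
      alternatingSum (λ j → N zero j * D j) + alternatingSum (λ j → c zero * (r j * D j))
        ≈⟨ +-cong (lower-rows n c r M N e) (sym (*-distribˡ-alternatingSum (c zero) _)) ⟩
      (determinant N - alternatingSum (tail F)) + c zero * alternatingSum (λ j → r j * D j)
        ≈⟨ +-congˡ (*-congˡ (trans (sym (determinant-firstRow (r ∷ tail M)))
             (determinant-addFirstRow n (tail c) (r ∷ tail M) (r ∷ tail N) (λ l → refl)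
               (λ i l → e (suc i) l)))) ⟩
      (determinant N - alternatingSum (tail F)) + F zero
        ≈⟨ solve 3 (λ d s x → (d :- s) :+ x := d :+ (x :- s)) refl _ _ _ ⟩
      determinant N + (F zero - alternatingSum (tail F))
        ≈⟨ +-congˡ (alternatingSum-suc F) ⟨
      determinant N + alternatingSum F ∎
      where
      D F : Vector Carrier (suc n)
      D j = determinant (minor M zero j)
      -- Putting `r` in place of row `i` and then moving it to the top costs the sign of (-1)ⁱ,
      -- which the alternating sum supplies. Terms of higher order in `c` would contain `r` twice
      -- and do not appear.
      F i = c i * determinant (r ∷ (λ k → N (punchIn i k)))

    -- With the top row of `N` kept, only the updates of the other rows contribute. The minus sign
    -- is that of the transposition of `N zero` and `r`, once the sum over `j` has been reassembled
    -- into one determinant with these two rows on top.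
    lower-rows : ∀ n (c r : Vector Carrier (suc n)) (M N : Matrix (suc n) (suc n)) →
      (∀ i l → M i l ≈ N i l + c i * r l) →
      alternatingSum (λ j → N zero j * determinant (minor M zero j)) ≈
      determinant N -
      alternatingSum (λ i → c (suc i) * determinant (r ∷ (λ k → N (punchIn (suc i) k))))
    lower-rows zero    c r M N e = begin
      alternatingSum (λ j → N zero j * determinant (minor M zero j))
        ≈⟨ alternatingSum-cong (λ j → *-congˡ (determinant-cong λ ())) ⟩
      alternatingSum (λ j → N zero j * determinant (minor N zero j))
        ≈⟨ determinant-firstRow N ⟨
      determinant N
        ≈⟨ solve 1 (λ d → d := d :- con (0 , 0)) refl _ ⟩
      determinant N - 0#
        ≈⟨ +-congˡ (-‿cong (alternatingSum-empty _)) ⟨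
      determinant N - alternatingSum _ ∎
    lower-rows (suc n) c r M N e = begin
      alternatingSum (λ j → N zero j * determinant (minor M zero j))
        ≈⟨ alternatingSum-cong (λ j → trans
             (*-congˡ (determinant-rankOneUpdate n (tail c) (r ∘ punchIn j) _ _
               (λ i l → e (suc i) (punchIn j l))))
             (trans (distribˡ _ _ _) (+-congˡ (*-distribˡ-alternatingSum (N zero j) _)))) ⟩
      alternatingSum (λ j → N zero j * determinant (minor N zero j) +
        alternatingSum (λ i → N zero j * (c (suc i) * E i j)))
        ≈⟨ alternatingSum-+ _ _ ⟩
      alternatingSum (λ j → N zero j * determinant (minor N zero j)) +
        alternatingSum (λ j → alternatingSum (λ i → N zero j * (c (suc i) * E i j)))
        ≈⟨ +-cong (sym (determinant-firstRow N)) (alternatingSum-comm _) ⟩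
      determinant N +
        alternatingSum (λ i → alternatingSum (λ j → N zero j * (c (suc i) * E i j)))
        ≈⟨ +-congˡ (alternatingSum-cong inner) ⟩
      determinant N + alternatingSum (λ i → - F i)
        ≈⟨ +-congˡ (alternatingSum-neg F) ⟩
      determinant N - alternatingSum F ∎
      where
      E : Matrix (suc n) (suc (suc n))
      E i j = determinant ((r ∘ punchIn j) ∷ (λ k → minor N zero j (punchIn i k)))

      F : Vector Carrier (suc n)
      F i = c (suc i) * determinant (r ∷ (λ k → N (punchIn (suc i) k)))

      inner : ∀ i → alternatingSum (λ j → N zero j * (c (suc i) * E i j)) ≈ - F i
      inner i = begin
        alternatingSum (λ j → N zero j * (c (suc i) * E i j))
          ≈⟨ alternatingSum-cong (λ j → x∙yz≈y∙xz (N zero j) (c (suc i)) (E i j)) ⟩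
        alternatingSum (λ j → c (suc i) * (N zero j * E i j))
          ≈⟨ *-distribˡ-alternatingSum (c (suc i)) _ ⟨
        c (suc i) * alternatingSum (λ j → N zero j * E i j)
          ≈⟨ *-congˡ (alternatingSum-cong λ j → *-congˡ (determinant-cong
               λ { zero l → refl ; (suc k) l → refl })) ⟩
        c (suc i) * alternatingSum (λ j → N zero j * determinant (minor N₀rN zero j))
          ≈⟨ *-congˡ (determinant-firstRow N₀rN) ⟨
        c (suc i) * determinant N₀rN
          ≈⟨ *-congˡ (determinant-swap n N₀rN _ (λ l → refl) (λ l → refl) (λ k l → refl)) ⟩
        c (suc i) * - determinant (r ∷ (λ k → N (punchIn (suc i) k)))
          ≈⟨ -‿distribʳ-* _ _ ⟨
        - F i ∎
        where
        N₀rN : Matrix (suc (suc n)) (suc (suc n))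
        N₀rN = N zero ∷ r ∷ (λ k → N (suc (punchIn i k)))

  -- The first row of the product is a multiple of the first row of `A`. Clearing the multiples of
  -- that row from the other rows leaves the product of the smaller triangular factor with the
  -- remaining rows of `A`, to which induction applies minor by minor.
  determinant-lowerTriangular-* : ∀ {n} (L A : Matrix n n) →
    (∀ i k → i Fin.< k → L i k ≈ 0#) →
    determinant (λ i j → sum (λ k → L i k * A k j)) ≈ ∏ (λ i → L i i) * determinant A
  determinant-lowerTriangular-* {zero}  L A L≈0 = begin
    determinant {0} _     ≈⟨ determinant-empty _ ⟩
    1#                    ≈⟨ *-identityˡ 1# ⟨
    1# * 1#               ≈⟨ *-congˡ (determinant-empty A) ⟨
    1# * determinant A    ∎
  determinant-lowerTriangular-* {suc n} L A L≈0 = begin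
    determinant LA
      ≈⟨ determinant-firstRow LA ⟩
    alternatingSum (λ j → LA zero j * determinant (minor LA zero j))
      ≈⟨ alternatingSum-cong (λ j → trans (*-congʳ (firstRow j)) (*-assoc _ _ _)) ⟩
    alternatingSum (λ j → L zero zero * (A zero j * determinant (minor LA zero j)))
      ≈⟨ *-distribˡ-alternatingSum (L zero zero) _ ⟨
    L zero zero * alternatingSum (λ j → A zero j * determinant (minor LA zero j))
      ≈⟨ *-congˡ (determinant-firstRow (A zero ∷ tail LA)) ⟨
    L zero zero * determinant (A zero ∷ tail LA)
      ≈⟨ *-congˡ (determinant-addFirstRow n (λ i → L (suc i) zero) _ (A zero ∷ L′A′)
           (λ l → refl) (λ i l → +-comm _ _)) ⟩
    L zero zero * determinant (A zero ∷ L′A′)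
      ≈⟨ *-congˡ (determinant-firstRow (A zero ∷ L′A′)) ⟩
    L zero zero * alternatingSum (λ j → A zero j * determinant (λ i l → L′A′ i (punchIn j l)))
      ≈⟨ *-congˡ (alternatingSum-cong λ j → trans
           (*-congˡ (determinant-lowerTriangular-* (λ i k → L (suc i) (suc k)) (minor A zero j)
             (λ i k i<k → L≈0 (suc i) (suc k) (s≤s i<k))))
           (x∙yz≈y∙xz _ _ _)) ⟩
    L zero zero * alternatingSum (λ j → ∏L′ * (A zero j * determinant (minor A zero j)))
      ≈⟨ *-congˡ (*-distribˡ-alternatingSum ∏L′ _) ⟨
    L zero zero * (∏L′ * alternatingSum (λ j → A zero j * determinant (minor A zero j)))
      ≈⟨ *-assoc _ _ _ ⟨
    L zero zero * ∏L′ * alternatingSum (λ j → A zero j * determinant (minor A zero j))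
      ≈⟨ *-congˡ (determinant-firstRow A) ⟨
    L zero zero * ∏L′ * determinant A ∎
    where
    LA : Matrix (suc n) (suc n)
    LA i j = sum (λ k → L i k * A k j)

    -- Rectangular: deleting column `j` gives the smaller triangular factor times `minor A zero j`,
    -- with the same left factor for every `j`.
    L′A′ : Matrix n (suc n)
    L′A′ i j = sum (λ k → L (suc i) (suc k) * A (suc k) j)

    ∏L′ : Carrier
    ∏L′ = ∏ (λ i → L (suc i) (suc i))

    firstRow : ∀ j → LA zero j ≈ L zero zero * A zero j
    firstRow j = trans (+-congˡ (trans
      (sum-cong-≋ (λ k → trans (*-congʳ (L≈0 zero (suc k) (s≤s z≤n))) (zeroˡ _)))
      (sum-replicate-zero n))) (+-identityʳ _)

  determinant-upperTriangular : ∀ {n} (U : Matrix n n) →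
    (∀ k j → j Fin.< k → U k j ≈ 0#) → determinant U ≈ ∏ (λ i → U i i)
  determinant-upperTriangular {zero}  U U≈0 = determinant-empty U
  determinant-upperTriangular {suc n} U U≈0 = begin
    determinant U
      ≈⟨ trans (determinant-firstColumn U) (alternatingSum-suc _) ⟩
    U zero zero * determinant (minor U zero zero) -
      alternatingSum (λ i → U (suc i) zero * determinant (minor U (suc i) zero))
      ≈⟨ +-cong
           (*-congˡ (determinant-upperTriangular (minor U zero zero)
             (λ k j j<k → U≈0 (suc k) (suc j) (s≤s j<k))))
           (-‿cong (alternatingSum-zero λ i →
             trans (*-congʳ (U≈0 (suc i) zero (s≤s z≤n))) (zeroˡ _))) ⟩
    ∏ (λ i → U i i) - 0#
      ≈⟨ solve 1 (λ d → d :- con (0 , 0) := d) refl _ ⟩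
    ∏ (λ i → U i i) ∎

-- Factorization into triangular matrices

module Reduction {c ℓ : Level} (R : CommutativeRing c ℓ) (a : CommutativeRing.Carrier R) where

  open CommutativeRing R hiding (zero)
  open Determinant R
  open DeterminantProperties R
  open IntegerSolver R
  open import Algebra.Properties.Semiring.Exp semiring using (_^_; ^-congʳ; ^-homo-*)
  open import Algebra.Properties.Semiring.Mult semiring using (_×_)
  open import Algebra.Properties.Semiring.Sum semiring
    using (sum; sum-cong-≋; sum-replicate-zero)
  open import Relation.Binary.Reasoning.Setoid setoid
  module ProductProperties = Algebra.Properties.CommutativeMonoid.Sum *-commutativeMonoid

  Sequence : Set c
  Sequence = ℕ → Carrier

  -- Multiplication of the generating function by 1 / (1 - t).
  prefixSum : Sequence → Sequence
  prefixSum f zero    = f zero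
  prefixSum f (suc j) = prefixSum f j + f (suc j)

  -- Multiplication of the generating function of f by (a - 1) t + a t² + a t³ + ⋯,
  -- that is, by (a / (1 - t) + (1 - t)) - (a + 1).
  raise : Sequence → Sequence
  raise f zero    = 0#
  raise f (suc j) = a * prefixSum f j - f j

  prefixSum-cong : ∀ {f g} → (∀ j → f j ≈ g j) → ∀ j → prefixSum f j ≈ prefixSum g j
  prefixSum-cong e zero    = e zero
  prefixSum-cong e (suc j) = +-cong (prefixSum-cong e j) (e (suc j))

  prefixSum-linear : ∀ b f g j →
    prefixSum (λ i → b * f i + g i) j ≈ b * prefixSum f j + prefixSum g j
  prefixSum-linear b f g zero    = refl
  prefixSum-linear b f g (suc j) = trans (+-congʳ (prefixSum-linear b f g j))
    (solve 5 (λ b s t x y → (b :* s :+ t) :+ (b :* x :+ y) := b :* (s :+ x) :+ (t :+ y))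
      refl _ _ _ _ _)

  prefixSum-leading : ∀ f j → (∀ i → i ℕ.< j → f i ≈ 0#) → prefixSum f j ≈ f j
  prefixSum-leading f zero    f≈0 = refl
  prefixSum-leading f (suc j) f≈0 = trans
    (+-congʳ (trans (prefixSum-leading f j (λ i i<j → f≈0 i (ℕ.m<n⇒m<1+n i<j))) (f≈0 j (ℕ.n<1+n j))))
    (+-identityˡ _)

  raise-cong : ∀ {f g} → (∀ j → f j ≈ g j) → ∀ j → raise f j ≈ raise g j
  raise-cong e zero    = refl
  raise-cong e (suc j) = +-cong (*-congˡ (prefixSum-cong e j)) (-‿cong (e j))

  raise-linear : ∀ b f g j → raise (λ i → b * f i + g i) j ≈ b * raise f j + raise g j
  raise-linear b f g zero    = solve 1 (λ b → con (0 , 0) := b :* con (0 , 0) :+ con (0 , 0)) refl b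
  raise-linear b f g (suc j) = trans (+-congʳ (*-congˡ (prefixSum-linear b f g j)))
    (solve 6 (λ a b s t x y →
        a :* (b :* s :+ t) :- (b :* x :+ y) := b :* (a :* s :- x) :+ (a :* t :- y))
      refl _ _ _ _ _ _)

  prefixSum-zero : ∀ {f} → (∀ j → f j ≈ 0#) → ∀ j → prefixSum f j ≈ 0#
  prefixSum-zero e zero    = e zero
  prefixSum-zero e (suc j) = trans (+-cong (prefixSum-zero e j) (e (suc j))) (+-identityˡ 0#)

  raise-zero : ∀ j → raise (λ _ → 0#) j ≈ 0#
  raise-zero zero    = refl
  raise-zero (suc j) = trans (+-congʳ (*-congˡ (prefixSum-zero (λ _ → refl) j)))
    (solve 1 (λ a → a :* con (0 , 0) :- con (0 , 0) := con (0 , 0)) refl a)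

  raise-sum : ∀ {n} (b : Fin n → Carrier) (f : Fin n → Sequence) j →
    raise (λ i → sum (λ k → b k * f k i)) j ≈ sum (λ k → b k * raise (f k) j)
  raise-sum {zero}  b f j = raise-zero j
  raise-sum {suc n} b f j = trans (raise-linear (b zero) (f zero) _ j)
    (+-congˡ (raise-sum (λ k → b (suc k)) (λ k → f (suc k)) j))

  raises : Sequence → ℕ → Sequence
  raises f zero    = f
  raises f (suc k) = raise (raises f k)

  -- As w has no constant term, each `raise` increases the order of vanishing at t = 0: its value at
  -- `suc j` depends only on entries up to `j`.
  raises-below : ∀ f k j → j ℕ.< k → raises f k j ≈ 0#
  raises-below f (suc k) zero    j<k       = refl
  raises-below f (suc k) (suc j) (s≤s j<k) = begin
    a * prefixSum (raises f k) j - raises f k j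
      ≈⟨ +-cong (*-congˡ (trans (prefixSum-leading (raises f k) j
           (λ i i<j → raises-below f k i (ℕ.<-trans i<j j<k))) (raises-below f k j j<k)))
           (-‿cong (raises-below f k j j<k)) ⟩
    a * 0# - 0#
      ≈⟨ solve 1 (λ a → a :* con (0 , 0) :- con (0 , 0) := con (0 , 0)) refl a ⟩
    0# ∎

  raises-diagonal : ∀ f → f 0 ≈ 1# → ∀ k → raises f k k ≈ (a - 1#) ^ k
  raises-diagonal f f₀ zero    = f₀
  raises-diagonal f f₀ (suc k) = begin
    a * prefixSum (raises f k) k - raises f k k
      ≈⟨ +-congʳ (*-congˡ (prefixSum-leading (raises f k) k (raises-below f k))) ⟩
    a * raises f k k - raises f k k
      ≈⟨ solve 2 (λ a x → a :* x :- x := (a :- con (1 , 0)) :* x) refl _ _ ⟩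
    (a - 1#) * raises f k k
      ≈⟨ *-congˡ (raises-diagonal f f₀ k) ⟩
    (a - 1#) * (a - 1#) ^ k ∎

  -- Multiplication by w on coefficients with respect to powers of w; `raise` is the same
  -- multiplication on coefficients with respect to powers of t.
  shift : Sequence → Sequence
  shift f zero    = 0#
  shift f (suc k) = f k

  -- With u v = a, the coefficients of uⁱ + vⁱ as a polynomial in u + v - (a + 1).
  powerSum : ℕ → Sequence
  powerSum zero          zero          = 2 × 1#
  powerSum zero          (suc k)       = 0#
  powerSum (suc zero)    zero          = a + 1#
  powerSum (suc zero)    (suc zero)    = 1#
  powerSum (suc zero)    (suc (suc k)) = 0#
  -- Newton's recurrence p(i+2) = (u + v) p(i+1) - u v p(i), with u + v = w + (a + 1) and u v = a.
  -- The polynomials are Dickson polynomials with parameter a, evaluated at w + a + 1.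
  powerSum (suc (suc i)) k             =
    shift (powerSum (suc i)) k + ((a + 1#) * powerSum (suc i) k - a * powerSum i k)

  powerSum-above : ∀ i k → i ℕ.< k → powerSum i k ≈ 0#
  powerSum-above zero          (suc k)       i<k = refl
  powerSum-above (suc zero)    (suc zero)    (s≤s ())
  powerSum-above (suc zero)    (suc (suc k)) i<k = refl
  powerSum-above (suc (suc i)) (suc k)       (s≤s i<k) = begin
    powerSum (suc i) k + ((a + 1#) * powerSum (suc i) (suc k) - a * powerSum i (suc k))
      ≈⟨ +-cong (powerSum-above (suc i) k i<k) (+-cong
           (*-congˡ (powerSum-above (suc i) (suc k) (ℕ.m<n⇒m<1+n i<k)))
           (-‿cong (*-congˡ (powerSum-above i (suc k) (ℕ.m<n⇒m<1+n (ℕ.<-trans (ℕ.n<1+n i) i<k)))))) ⟩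
    0# + ((a + 1#) * 0# - a * 0#)
      ≈⟨ solve 2 (λ a b → con (0 , 0) :+ (b :* con (0 , 0) :- a :* con (0 , 0)) := con (0 , 0))
           refl a (a + 1#) ⟩
    0# ∎

  -- Stated from index one on: the entry at index zero is 2, the source of the factor 2 in the
  -- determinant.
  powerSum-diagonal : ∀ i → powerSum (suc i) (suc i) ≈ 1#
  powerSum-diagonal zero    = refl
  powerSum-diagonal (suc i) = begin
    powerSum (suc i) (suc i) +
      ((a + 1#) * powerSum (suc i) (suc (suc i)) - a * powerSum i (suc (suc i)))
      ≈⟨ +-cong (powerSum-diagonal i) (+-cong
           (*-congˡ (powerSum-above (suc i) (suc (suc i)) (ℕ.n<1+n _)))
           (-‿cong (*-congˡ (powerSum-above i (suc (suc i)) (ℕ.m<n⇒m<1+n (ℕ.n<1+n i)))))) ⟩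
    1# + ((a + 1#) * 0# - a * 0#)
      ≈⟨ solve 2 (λ a b → con (1 , 0) :+ (b :* con (0 , 0) :- a :* con (0 , 0)) := con (1 , 0))
           refl a (a + 1#) ⟩
    1# ∎

  -- The exponent is 0 + 1 + ⋯ + (n - 1). Taking one `q` out of each factor after the first leaves
  -- the product of size `n`, and the exponents add up by Pascal's rule.
  ∏-powers : ∀ n q → ∏ {n} (λ k → q ^ toℕ k) ≈ q ^ (n C 2)
  ∏-powers zero    q = refl
  ∏-powers (suc n) q = begin
    1# * ∏ {n} (λ k → q * q ^ toℕ k)     ≈⟨ *-identityˡ _ ⟩
    ∏ {n} (λ k → q * q ^ toℕ k)          ≈⟨ ProductProperties.∑-distrib-+ {n} (λ _ → q) (λ k → q ^ toℕ k) ⟩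
    ∏ {n} (λ _ → q) * ∏ {n} (λ k → q ^ toℕ k) ≈⟨ *-cong (ProductProperties.sum-replicate n) (∏-powers n q) ⟩
    q ^ n * q ^ (n C 2)                  ≈⟨ ^-homo-* q n (n C 2) ⟨
    q ^ (n ℕ.+ n C 2)                    ≈⟨ ^-congʳ q n+nC2≡[n+1]C2 ⟩
    q ^ (suc n C 2)                      ∎
    where
    n+nC2≡[n+1]C2 : n ℕ.+ n C 2 ≡ suc n C 2
    n+nC2≡[n+1]C2 = ≡.trans (≡.cong (ℕ._+ n C 2) (≡.sym (nC1≡n n))) (nCk+nC[k+1]≡[n+1]C[k+1] n 1)

  -- `F i` and `G i` stand for the coefficients of (1 - t)^(-x-i) and (1 - t)^(-x+i). The last two
  -- hypotheses say that division by 1 - t takes `F i` to `F (suc i)` and `G (suc i)` to `G i`.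
  module _ (F G : ℕ → Sequence)
           (F≈G   : ∀ j → F 0 j ≈ G 0 j)
           (F-0   : ∀ i → F i 0 ≈ 1#)
           (G-0   : ∀ i → G i 0 ≈ 1#)
           (F-suc : ∀ i j → F (suc i) (suc j) ≈ F (suc i) j + F i (suc j))
           (G-suc : ∀ i j → G i (suc j) ≈ G i j + G (suc i) (suc j)) where

    row : ℕ → Sequence
    row i j = a ^ i * F i j + G i j

    prefixSum-F : ∀ i j → prefixSum (F i) j ≈ F (suc i) j
    prefixSum-F i zero    = trans (F-0 i) (sym (F-0 (suc i)))
    prefixSum-F i (suc j) = trans (+-congʳ (prefixSum-F i j)) (sym (F-suc i j))

    prefixSum-G : ∀ i j → prefixSum (G (suc i)) j ≈ G i j
    prefixSum-G i zero    = trans (G-0 (suc i)) (sym (G-0 i))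
    prefixSum-G i (suc j) = trans (+-congʳ (prefixSum-G i j)) (sym (G-suc i j))

    -- Newton's recurrence multiplied by (1 - t)^(-x): the recurrence of `powerSum` with `raise` in
    -- place of `shift`.
    row-suc-suc : ∀ i j →
      row (suc (suc i)) j ≈ raise (row (suc i)) j + ((a + 1#) * row (suc i) j - a * row i j)
    row-suc-suc i zero = begin
      a * (a * a ^ i) * F (suc (suc i)) 0 + G (suc (suc i)) 0
        ≈⟨ +-cong (*-congˡ (F-0 _)) (G-0 _) ⟩
      a * (a * a ^ i) * 1# + 1#
        ≈⟨ solve 2 (λ a A → let 1′ = con (1 , 0) in
             a :* (a :* A) :* 1′ :+ 1′ :=
             con (0 , 0) :+ ((a :+ 1′) :* (a :* A :* 1′ :+ 1′) :- a :* (A :* 1′ :+ 1′)))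
             refl a (a ^ i) ⟩
      0# + ((a + 1#) * (a * a ^ i * 1# + 1#) - a * (a ^ i * 1# + 1#))
        ≈⟨ +-congˡ (+-cong (*-congˡ (+-cong (*-congˡ (F-0 _)) (G-0 _)))
             (-‿cong (*-congˡ (+-cong (*-congˡ (F-0 _)) (G-0 _))))) ⟨
      0# + ((a + 1#) * row (suc i) 0 - a * row i 0) ∎
    row-suc-suc i (suc j) = begin
      a * (a * a ^ i) * F (suc (suc i)) (suc j) + G (suc (suc i)) (suc j)
        ≈⟨ +-congʳ (*-congˡ (trans (F-suc (suc i) j) (+-congˡ (F-suc i j)))) ⟩
      a * (a * A) * (F″ + (F′ + F₊)) + G″₊
        -- Pascal's rule has reduced all entries to six, treated as independent, and the claim to a
        -- polynomial identity in them, `a` and `A`.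
        ≈⟨ solve 8 (λ a A F″ F′ F₊ G₀ G′ G″₊ →
             a :* (a :* A) :* (F″ :+ (F′ :+ F₊)) :+ G″₊ :=
             (a :* (a :* A :* F″ :+ G₀) :- (a :* A :* F′ :+ G′)) :+
             ((a :+ con (1 , 0)) :* (a :* A :* (F′ :+ F₊) :+ (G′ :+ G″₊)) :-
              a :* (A :* F₊ :+ (G₀ :+ (G′ :+ G″₊)))))
             refl a A F″ F′ F₊ G₀ G′ G″₊ ⟩
      (a * (a * A * F″ + G₀) - (a * A * F′ + G′)) +
        ((a + 1#) * (a * A * (F′ + F₊) + (G′ + G″₊)) - a * (A * F₊ + (G₀ + (G′ + G″₊))))
        ≈⟨ +-cong
             (+-congʳ (*-congˡ (trans (prefixSum-linear (a * A) (F (suc i)) (G (suc i)) j)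
               (+-cong (*-congˡ (prefixSum-F (suc i) j)) (prefixSum-G i j)))))
             (+-cong
               (*-congˡ (+-cong (*-congˡ (F-suc i j)) (G-suc (suc i) j)))
               (-‿cong (*-congˡ (+-congˡ (trans (G-suc i j) (+-congˡ (G-suc (suc i) j))))))) ⟨
      raise (row (suc i)) (suc j) + ((a + 1#) * row (suc i) (suc j) - a * row i (suc j)) ∎
      where
      A   = a ^ i
      F″  = F (suc (suc i)) j
      F′  = F (suc i) j
      F₊  = F i (suc j)
      G₀  = G i j
      G′  = G (suc i) j
      G″₊ = G (suc (suc i)) (suc j)

    -- Both sides obey the same second-order recurrence in `i`, so two initial rows start the
    -- induction. The number of terms stays variable, since the recurrence uses expansions of two
    -- lengths.
    row-expansion : ∀ {n} i j → i ℕ.< n →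
      row i j ≈ sum {n} (λ k → powerSum i (toℕ k) * raises (F 0) (toℕ k) j)
    row-expansion {suc n} zero j i<n = begin
      1# * F 0 j + G 0 j
        ≈⟨ +-congˡ (F≈G j) ⟨
      1# * F 0 j + F 0 j
        ≈⟨ solve 1 (λ f → con (1 , 0) :* f :+ f :=
             (con (1 , 0) :+ (con (1 , 0) :+ con (0 , 0))) :* f :+ con (0 , 0)) refl _ ⟩
      2 × 1# * F 0 j + 0#
        ≈⟨ +-congˡ (zeros n (λ k → raises (F 0) (suc (toℕ k)) j)) ⟨
      _ ∎
      where
      zeros : ∀ n (f : Fin n → Carrier) → sum (λ k → 0# * f k) ≈ 0#
      zeros n f = trans (sum-cong-≋ (λ k → zeroˡ (f k))) (sum-replicate-zero n)
    row-expansion {suc zero} (suc i) j (s≤s ())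
    row-expansion {suc (suc n)} (suc zero) j i<n = begin
      a * 1# * F 1 j + G 1 j
        ≈⟨ firstRow j ⟩
      (a + 1#) * F 0 j + (1# * raise (F 0) j + 0#)
        ≈⟨ +-congˡ (+-congˡ (trans
             (sum-cong-≋ {n} (λ k → zeroˡ (raises (F 0) (suc (suc (toℕ k))) j)))
             (sum-replicate-zero n))) ⟨
      _ ∎
      where
      firstRow : ∀ j → a * 1# * F 1 j + G 1 j ≈ (a + 1#) * F 0 j + (1# * raise (F 0) j + 0#)
      firstRow zero = begin
        a * 1# * F 1 0 + G 1 0
          ≈⟨ +-cong (*-congˡ (F-0 1)) (G-0 1) ⟩
        a * 1# * 1# + 1#
          ≈⟨ solve 1 (λ a → let 1′ = con (1 , 0) ; 0′ = con (0 , 0) in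
               a :* 1′ :* 1′ :+ 1′ := (a :+ 1′) :* 1′ :+ (1′ :* 0′ :+ 0′)) refl a ⟩
        (a + 1#) * 1# + (1# * 0# + 0#)
          ≈⟨ +-congʳ (*-congˡ (F-0 0)) ⟨
        (a + 1#) * F 0 0 + (1# * 0# + 0#) ∎
      firstRow (suc j) = begin
        a * 1# * F 1 (suc j) + G 1 (suc j)
          ≈⟨ +-congʳ (*-congˡ (F-suc 0 j)) ⟩
        a * 1# * (F 1 j + F 0 (suc j)) + G 1 (suc j)
          ≈⟨ solve 5 (λ a F₁ F₀₊ F₀ G₁₊ → let 1′ = con (1 , 0) ; 0′ = con (0 , 0) in
               a :* 1′ :* (F₁ :+ F₀₊) :+ G₁₊ :=
               (a :* F₀₊ :+ (F₀ :+ G₁₊)) :+ (1′ :* (a :* F₁ :- F₀) :+ 0′)) refl _ _ _ (F 0 j) _ ⟩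
        (a * F 0 (suc j) + (F 0 j + G 1 (suc j))) + (1# * (a * F 1 j - F 0 j) + 0#)
          ≈⟨ +-cong
               (trans (distribʳ _ a 1#) (+-congˡ (trans (*-identityˡ _)
                 (trans (F≈G (suc j)) (trans (G-suc 0 j) (+-congʳ (sym (F≈G j))))))))
               (+-congʳ (*-congˡ (+-congʳ (*-congˡ (prefixSum-F 0 j))))) ⟨
        (a + 1#) * F 0 (suc j) + (1# * (a * prefixSum (F 0) j - F 0 j) + 0#) ∎
    row-expansion {suc n} (suc (suc i)) j (s≤s i<n) = begin
      row (suc (suc i)) j
        ≈⟨ row-suc-suc i j ⟩
      raise (row (suc i)) j + ((a + 1#) * row (suc i) j - a * row i j)
        ≈⟨ +-cong
             -- Row `suc i` is expanded with only `n` terms here: `raise` moves them to the indices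
             -- 1 to `n`, and the zero at the head of `shift` completes them to `suc n` terms.
             (trans (raise-cong (λ j → row-expansion {n} (suc i) j i<n) j)
               (raise-sum {n} (λ k → powerSum (suc i) (toℕ k)) (λ k → raises (F 0) (toℕ k)) j))
             (+-cong (*-congˡ (row-expansion {suc n} (suc i) j (ℕ.m<n⇒m<1+n i<n)))
               (-‿cong (*-congˡ (row-expansion {suc n} i j
                 (ℕ.m<n⇒m<1+n (ℕ.<-trans (ℕ.n<1+n i) i<n)))))) ⟩
      sum {n} (λ k → L (suc i) (toℕ k) * V (suc (toℕ k))) +
        ((a + 1#) * sum {suc n} (λ k → L (suc i) (toℕ k) * V (toℕ k)) -
         a * sum {suc n} (λ k → L i (toℕ k) * V (toℕ k)))
        ≈⟨ +-congʳ (trans (+-congʳ (zeroˡ (V 0))) (+-identityˡ _)) ⟨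
      sum {suc n} (λ k → shift (L (suc i)) (toℕ k) * V (toℕ k)) +
        ((a + 1#) * sum {suc n} (λ k → L (suc i) (toℕ k) * V (toℕ k)) -
         a * sum {suc n} (λ k → L i (toℕ k) * V (toℕ k)))
        ≈⟨ combine (suc n) (shift (L (suc i))) (L (suc i)) (L i) (a + 1#) a V ⟩
      sum {suc n} (λ k → L (suc (suc i)) (toℕ k) * V (toℕ k)) ∎
      where
      L : ℕ → Sequence
      L = powerSum
      V : Sequence
      V k = raises (F 0) k j
      combine : ∀ n (p q r : Sequence) b d (v : Sequence) →
        sum {n} (λ k → p (toℕ k) * v (toℕ k)) +
          (b * sum {n} (λ k → q (toℕ k) * v (toℕ k)) -
           d * sum {n} (λ k → r (toℕ k) * v (toℕ k))) ≈
        sum {n} (λ k → (p (toℕ k) + (b * q (toℕ k) - d * r (toℕ k))) * v (toℕ k))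
      combine zero    p q r b d v =
        solve 2 (λ b d → let 0′ = con (0 , 0) in 0′ :+ (b :* 0′ :- d :* 0′) := 0′) refl b d
      combine (suc n) p q r b d v = trans
        (solve 9 (λ p q r b d v s t u →
            (p :* v :+ s) :+ (b :* (q :* v :+ t) :- d :* (r :* v :+ u)) :=
            (p :+ (b :* q :- d :* r)) :* v :+ (s :+ (b :* t :- d :* u)))
          refl (p 0) (q 0) (r 0) b d (v 0) _ _ _)
        (+-congˡ (combine n (λ k → p (suc k)) (λ k → q (suc k)) (λ k → r (suc k)) b d
          (λ k → v (suc k))))

    -- The lower factor has diagonal 2 followed by `m` ones. A matrix of size zero lacks the entry 2
    -- and has determinant 1, hence `NonZero`.
    det-rows : ∀ n → .{{_ : NonZero n}} →
      det n (λ i j → row (toℕ i) (toℕ j)) ≈ 2 × 1# * (a - 1#) ^ (n C 2)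
    det-rows n@(suc m) = begin
      det n (λ i j → row (toℕ i) (toℕ j))
        ≈⟨ det≈determinant _ ⟩
      determinant (λ i j → row (toℕ i) (toℕ j))
        ≈⟨ determinant-cong (λ i j → row-expansion (toℕ i) (toℕ j) (toℕ<n i)) ⟩
      determinant (λ i j → sum (λ k → L i k * V k j))
        ≈⟨ determinant-lowerTriangular-* L V (λ i k i<k → powerSum-above (toℕ i) (toℕ k) i<k) ⟩
      ∏ (λ i → L i i) * determinant V
        ≈⟨ *-cong
             (*-congˡ (trans (∏-cong {m} (λ i → powerSum-diagonal (toℕ i)))
               (ProductProperties.sum-replicate-zero m)))
             (determinant-upperTriangular V (λ k j j<k → raises-below (F 0) (toℕ k) (toℕ j) j<k)) ⟩
      2 × 1# * 1# * ∏ (λ k → V k k)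
        ≈⟨ *-cong (*-identityʳ _) (∏-cong {n} (λ k → raises-diagonal (F 0) (F-0 0) (toℕ k))) ⟩
      2 × 1# * ∏ {n} (λ k → (a - 1#) ^ toℕ k)
        ≈⟨ *-congˡ (∏-powers n (a - 1#)) ⟩
      2 × 1# * (a - 1#) ^ (n C 2) ∎
      where
      L V : Matrix n n
      L i k = powerSum (toℕ i) (toℕ k)
      V k j = raises (F 0) (toℕ k) (toℕ j)

-- Pascal's rule and the binomial determinant

module BinomialProperties {c ℓ : Level} (R : CommutativeRing c ℓ) where

  open CommutativeRing R hiding (zero)
  open IntegerSolver R
  open Determinant R
  open import Algebra.Properties.Semiring.Exp semiring using (_^_)
  open import Algebra.Properties.Semiring.Mult semiring using (_×_; ×1-homo-*)
  open import Relation.Binary.Reasoning.Setoid setoid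

  module _ (scalar : ℚ.ℚ → Carrier)
           (scalar-reciprocal : ∀ n → .{{_ : NonZero n}} → scalar (1ℤ ℚ./ n) * (n × 1#) ≈ 1#) where

    open Binomial R scalar

    fallingFactorial-cong : ∀ {α β} p → α ≈ β → fallingFactorial α p ≈ fallingFactorial β p
    fallingFactorial-cong zero    e = refl
    fallingFactorial-cong (suc p) e = *-cong (fallingFactorial-cong p e) (+-congʳ e)

    -- The definition splits off the last factor; raising the argument by one exposes the first
    -- factor instead.
    fallingFactorial-suc : ∀ α p →
      fallingFactorial (α + 1#) (suc p) ≈ (α + 1#) * fallingFactorial α p
    fallingFactorial-suc α zero    = solve 1 (λ α → let 1′ = con (1 , 0) in
      1′ :* (α :+ 1′ :- con (0 , 0)) := (α :+ 1′) :* 1′) refl α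
    fallingFactorial-suc α (suc p) = trans (*-congʳ (fallingFactorial-suc α p))
      (solve 3 (λ α f k → let 1′ = con (1 , 0) in
        (α :+ 1′) :* f :* (α :+ 1′ :- (1′ :+ k)) := (α :+ 1′) :* (f :* (α :- k)))
        refl α (fallingFactorial α p) (p × 1#))

    -- Uniqueness of inverses: insert `1#` as `s` times `p !`, then cancel `s′` against `suc p !`.
    scalar-1/! : ∀ p → scalar (1/ suc p !) * (suc p × 1#) ≈ scalar (1/ p !)
    scalar-1/! p = begin
      s′ * k
        ≈⟨ *-identityʳ _ ⟨
      s′ * k * 1#
        ≈⟨ *-congˡ (scalar-reciprocal (p !)) ⟨
      s′ * k * (s * ((p !) × 1#))
        ≈⟨ solve 4 (λ s′ k s m → s′ :* k :* (s :* m) := s′ :* (k :* m) :* s) refl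
             s′ k s ((p !) × 1#) ⟩
      s′ * (k * ((p !) × 1#)) * s
        ≈⟨ *-congʳ (*-congˡ (×1-homo-* (suc p) (p !))) ⟨
      s′ * ((suc p !) × 1#) * s
        ≈⟨ *-congʳ (scalar-reciprocal (suc p !)) ⟩
      1# * s
        ≈⟨ *-identityˡ s ⟩
      s ∎
      where
      instance
        p!≢0 : NonZero (p !)
        p!≢0 = p !≢0
        [1+p]!≢0 : NonZero (suc p !)
        [1+p]!≢0 = suc p !≢0
      s  = scalar (1/ p !)
      s′ = scalar (1/ suc p !)
      k  = suc p × 1#

    binomial-cong : ∀ {α β} p → α ≈ β → binomial α (+ p) ≈ binomial β (+ p)
    binomial-cong p e = *-congˡ (fallingFactorial-cong p e)

    binomial-zero : ∀ α → binomial α (+ 0) ≈ 1#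
    binomial-zero α = trans (*-congˡ (sym (+-identityʳ 1#))) (scalar-reciprocal 1)

    -- Split the leading factor α + 1 as (p + 1) + (α - p): the first part turns 1/(p+1)! into 1/p!,
    -- the second extends the falling factorial of α by its next factor.
    pascal : ∀ α p → binomial (α + 1#) (+ suc p) ≈ binomial α (+ p) + binomial α (+ suc p)
    pascal α p = begin
      s′ * fallingFactorial (α + 1#) (suc p)
        ≈⟨ *-congˡ (fallingFactorial-suc α p) ⟩
      s′ * ((α + 1#) * f)
        ≈⟨ solve 4 (λ s′ α f k → let 1′ = con (1 , 0) in
             s′ :* ((α :+ 1′) :* f) := s′ :* (1′ :+ k) :* f :+ s′ :* (f :* (α :- k)))
             refl s′ α f (p × 1#) ⟩
      s′ * (suc p × 1#) * f + s′ * (f * (α - p × 1#))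
        ≈⟨ +-congʳ (*-congʳ (scalar-1/! p)) ⟩
      scalar (1/ p !) * f + s′ * (f * (α - p × 1#)) ∎
      where
      s′ = scalar (1/ suc p !)
      f  = fallingFactorial α p

    det-binomial : ∀ a x n → .{{_ : NonZero n}} →
      det n (λ i j →
          a ^ toℕ i * binomial (x + toℕ i × 1# + toℕ j × 1# - 1#) (+ toℕ j)
        + binomial (x - toℕ i × 1# + toℕ j × 1# - 1#) (+ toℕ j))
      ≈ 2 × 1# * (a - 1#) ^ (n C 2)
    det-binomial a x = Reduction.det-rows R a F G
      (λ j → binomial-cong j (solve 2 (λ x j →
        x :+ 0′ :+ j :- 1′ := x :- 0′ :+ j :- 1′) refl x (j × 1#)))
      (λ i → binomial-zero (x + i × 1# + 0# - 1#))
      (λ i → binomial-zero (x - i × 1# + 0# - 1#))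
      (λ i j → pascal-at j
        (solve 3 (λ x i j → x :+ (1′ :+ i) :+ (1′ :+ j) :- 1′ := x :+ (1′ :+ i) :+ j :- 1′ :+ 1′)
          refl x (i × 1#) (j × 1#))
        (solve 3 (λ x i j → x :+ (1′ :+ i) :+ j :- 1′ := x :+ i :+ (1′ :+ j) :- 1′)
          refl x (i × 1#) (j × 1#)))
      (λ i j → pascal-at j
        (solve 3 (λ x i j → x :- i :+ (1′ :+ j) :- 1′ := x :- i :+ j :- 1′ :+ 1′)
          refl x (i × 1#) (j × 1#))
        (solve 3 (λ x i j → x :- i :+ j :- 1′ := x :- (1′ :+ i) :+ (1′ :+ j) :- 1′)
          refl x (i × 1#) (j × 1#)))
      where
      0′ 1′ : ∀ {n} → Polynomial n
      0′ = con (0 , 0)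
      1′ = con (1 , 0)

      F G : ℕ → ℕ → Carrier
      F i j = binomial (x + i × 1# + j × 1# - 1#) (+ j)
      G i j = binomial (x - i × 1# + j × 1# - 1#) (+ j)

      -- One upper argument arises in two forms, such as x + (i + 1) + j - 1 and x + i + (j + 1) -
      -- 1; this coincidence lets Pascal's rule link neighbouring rows.
      pascal-at : ∀ {α β γ} p → γ ≈ α + 1# → α ≈ β →
        binomial γ (+ suc p) ≈ binomial α (+ p) + binomial β (+ suc p)
      pascal-at {α} p γ≈α+1 α≈β = trans (binomial-cong (suc p) γ≈α+1)
        (trans (pascal α p) (+-congˡ (binomial-cong (suc p) α≈β)))

-- Reciprocals of positive integers in ℚ[a,x]

module Constants {c ℓ : Level} (R : CommutativeRing c ℓ) where

  open Polynomial R
  open import Algebra.Properties.Semiring.Mult (CommutativeRing.semiring R)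
    renaming (_×_ to _×₀_)
  open import Algebra.Properties.Semiring.Mult (CommutativeRing.semiring commutativeRing)
  private
    module R = CommutativeRing R
    module R[X] = CommutativeRing commutativeRing

  constant-cong : ∀ {a b} → a R.≈ b → constant a ≋ constant b
  constant-cong e = ∷-cong e R[X].refl

  ×-constant : ∀ n a → n × constant a ≋ constant (n ×₀ a)
  ×-constant zero    a = R[X].sym 0∷[]≋[]
  ×-constant (suc n) a = R[X].+-congˡ (×-constant n a)

import Algebra.Properties.Semiring.Mult (CommutativeRing.semiring ℚ-ring) as ℚ-Mult

-- Reduced fractions do not compute for a variable denominator, so the sum is taken among unreduced
-- ones, where the claim is an identity of integers.
/-homo-+ : ∀ i j n → .{{_ : NonZero n}} → (i ℚ./ n) ℚ.+ (j ℚ./ n) ≡ (i ℤ.+ j) ℚ./ n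
/-homo-+ i j n@(suc d) = ℚ.toℚᵘ-injective (begin
  ℚ.toℚᵘ (i ℚ./ n ℚ.+ j ℚ./ n)                ≈⟨ ℚ.toℚᵘ-homo-+ (i ℚ./ n) (j ℚ./ n) ⟩
  ℚ.toℚᵘ (i ℚ./ n) ℚᵘ.+ ℚ.toℚᵘ (j ℚ./ n)      ≈⟨ ℚᵘ.+-cong (ℚ.toℚᵘ-fromℚᵘ (mkℚᵘ i d)) (ℚ.toℚᵘ-fromℚᵘ (mkℚᵘ j d)) ⟩
  mkℚᵘ i d ℚᵘ.+ mkℚᵘ j d                      ≈⟨ *≡* (common-denominator i j (+ n)) ⟩
  mkℚᵘ (i ℤ.+ j) d                            ≈⟨ ℚ.toℚᵘ-fromℚᵘ (mkℚᵘ (i ℤ.+ j) d) ⟨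
  ℚ.toℚᵘ ((i ℤ.+ j) ℚ./ n)                    ∎)
  where
  open import Relation.Binary.Reasoning.Setoid ℚᵘ.≃-setoid
  open ℤ.+-*-Solver
  common-denominator : ∀ i j n → (i ℤ.* n ℤ.+ j ℤ.* n) ℤ.* n ≡ (i ℤ.+ j) ℤ.* (n ℤ.* n)
  common-denominator = solve 3 (λ i j n → (i :* n :+ j :* n) :* n := (i :+ j) :* (n :* n)) ≡.refl

×-1/ : ∀ k n → .{{_ : NonZero n}} → k ℚ-Mult.× (1ℤ ℚ./ n) ≡ + k ℚ./ n
×-1/ zero    n = ≡.sym (ℚ.0/n≡0 n)
×-1/ (suc k) n = ≡.trans (≡.cong (1ℤ ℚ./ n ℚ.+_) (×-1/ k n)) (/-homo-+ 1ℤ (+ k) n)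

n/n≡1 : ∀ n → .{{_ : NonZero n}} → + n ℚ./ n ≡ ℚ.1ℚ
n/n≡1 (suc d) = ℚ.fromℚᵘ-cong {mkℚᵘ (+ suc d) d} {mkℚᵘ 1ℤ 0}
  (*≡* (≡.trans (ℤ.*-identityʳ (+ suc d)) (≡.sym (ℤ.*-identityˡ (+ suc d)))))

open import Defs

-- The multiple is carried through both layers of constant polynomials into ℚ, where `n` copies of
-- 1/n add up to n/n.
scalar-reciprocal : ∀ n → .{{_ : NonZero n}} → scalar (1ℤ ℚ./ n) * fromℕ n ≈ 1#
scalar-reciprocal n = begin
  scalar q * fromℕ n         ≈⟨ ×-comm-* n (scalar q) 1# ⟩
  n × (scalar q * 1#)        ≈⟨ ×-congʳ n (*-identityʳ (scalar q)) ⟩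
  n × scalar q               ≈⟨ ℚ[a]-constants.×-constant n (constant q) ⟩
  Polynomial.constant ℚ[a] (n ℚ[a]-Mult.× constant q)
    ≈⟨ ℚ[a]-constants.constant-cong (ℚ-constants.×-constant n q) ⟩
  scalar (n ℚ-Mult.× q)      ≡⟨ ≡.cong scalar (≡.trans (×-1/ n n) (n/n≡1 n)) ⟩
  1#                         ∎
  where
  open CommutativeRing ℚ[a,x] using (setoid; *-identityʳ; semiring)
  open import Algebra.Properties.Semiring.Mult semiring using (×-comm-*; ×-congʳ)
  import Algebra.Properties.Semiring.Mult (CommutativeRing.semiring ℚ[a]) as ℚ[a]-Mult
  open import Relation.Binary.Reasoning.Setoid setoid
  open Polynomial ℚ-ring using (constant)
  module ℚ-constants = Constants ℚ-ring
  module ℚ[a]-constants = Constants ℚ[a]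
  q : ℚ.ℚ
  q = 1ℤ ℚ./ n

theorem3 : (n : ℕ) → .{{_ : NonZero n}} →
    det n (λ i j →
        a ^ toℕ i * binomial (x + fromℕ (toℕ i) + fromℕ (toℕ j) - 1#) (+ toℕ j)
      + binomial (x - fromℕ (toℕ i) + fromℕ (toℕ j) - 1#) (+ toℕ j))
    ≈ fromℕ 2 * (a - 1#) ^ (n C 2)
theorem3 = BinomialProperties.det-binomial ℚ[a,x] scalar scalar-reciprocal a x
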